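{- If $\mathcal R$ is a TRS that is complete modulo $\mathcal B$, then $\ddot{\mathcal R}$ is a TRS which is normalization equivalent modulo $\mathcal B$ to $\mathcal R$, conversion equivalent modulo $\mathcal B$ to $\mathcal R$, and canonical modulo $\mathcal B$.
   Context: Terms over a signature $\mathcal F$; $s\to_{\mathcal R}t$ is the usual rewrite relation (closure under contexts and substitutions), $\leftarrow$ its inverse. $\mathcal B$ is a fixed ES with $\mathrm{Var}(\ell)=\mathrm{Var}(r)$ for all $\ell\approx r\in\mathcal B$, $\sim_{\mathcal B}=\leftrightarrow^*_{\mathcal B}$, $\to_{\mathcal R/\mathcal B}=\sim_{\mathcal B}\cdot\to_{\mathcal R}\cdot\sim_{\mathcal B}$. $\mathcal R$ is terminating modulo $\mathcal B$ if $\to_{\mathcal R/\mathcal B}$ has no infinite sequence; Church–Rosser modulo $\mathcal B$ if $\leftrightarrow^*_{\mathcal R\cup\mathcal B}\subseteq\to^*_{\mathcal R}\cdot\sim_{\mathcal B}\cdot\leftarrow^*_{\mathcal R}$; complete modulo $\mathcal B$ if both. TRSs $\mathcal R,\mathcal S$ are normalization equivalent modulo $\mathcal B$ if $\to^!_{\mathcal R}\cdot\sim_{\mathcal B}=\to^!_{\mathcal S}\cdot\sim_{\mathcal B}$ ($a\to^!b$: $a\to^*b$ with $b$ a normal form), and conversion equivalent modulo $\mathcal B$ if $\leftrightarrow^*_{\mathcal R\cup\mathcal B}=\leftrightarrow^*_{\mathcal S\cup\mathcal B}$. Two rules $\ell\to r,\ell'\to r'$ are right-$\mathcal B$-equivalent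 variants if there is a renaming $\sigma$ with $\ell\sigma=\ell'$ and $r\sigma\sim_{\mathcal B}r'$; for a TRS $\mathcal T$, $\mathcal T_{\simeq}$ denotes a subset of $\mathcal T$ containing exactly one representative of each class of rules of $\mathcal T$ that are right-$\mathcal B$-equivalent variants of each other. A TRS is left-reduced if for every rule $\ell\to r$, $\ell$ is a normal form of the TRS without that rule; right-$\mathcal B$-reduced if for every rule $\ell\to r$, $r$ is a normal form of $\to_{\mathcal R/\mathcal B}$; canonical modulo $\mathcal B$ if complete modulo $\mathcal B$, left-reduced and right-$\mathcal B$-reduced. For $\mathcal R$ terminating modulo $\mathcal B$: $\dot{\mathcal R}=\{\ell\to r{\downarrow_{\mathcal R/\mathcal B}}\mid\ell\to r\in\mathcal R\}_{\simeq}$, where $r{\downarrow_{\mathcal R/\mathcal B}}$ is an arbitrary normal form of $r$ w.r.t. $\to_{\mathcal R/\mathcal B}$, and $\ddot{\mathcal R}=\{\ell\to r\in\dot{\mathcal R}\mid \ell\text{ is a normal form of }\dot{\mathcal R}\setminus\{\ell\to r\}\}$. -}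

module Defs where

open import Level using (0ℓ)
open import Data.Fin.Base using (Fin)
open import Data.Nat.Base using (ℕ)
open import Data.Product.Base using (_×_; _,_; ∃; ∃-syntax; Σ-syntax)
open import Data.Vec.Base using (Vec; []; _∷_; _[_]≔_)
open import Data.Vec.Relation.Unary.Any using (Any)
open import Function.Base using (_∘_; flip)
open import Function.Bundles using (_↔_; Inverse)
open import Induction.InfiniteDescent using (InfiniteDescendingSequence)
open import Relation.Binary.Core using (Rel; _⇒_; _⇔_)
open import Relation.Binary.Construct.Closure.Equivalence using (EqClosure)
open import Relation.Binary.Construct.Closure.ReflexiveTransitive using (Star)
open import Relation.Binary.Construct.Composition using () renaming (_;_ to _⨾_)
open import Relation.Binary.Construct.Union using (_∪_)
open import Relation.Binary.PropositionalEquality.Core using (_≡_; _≢_)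
open import Relation.Binary.Rewriting using (IsNormalForm)
open import Relation.Nullary.Negation.Core using (¬_)

record Signature : Set₁ where
  field
    Symbol : Set
    arity  : Symbol → ℕ

open Signature public

Var : Set
Var = ℕ

data Term (𝓕 : Signature) : Set where
  var : Var → Term 𝓕
  fun : (f : Symbol 𝓕) → Vec (Term 𝓕) (arity 𝓕 f) → Term 𝓕

data _∈Var_ {𝓕 : Signature} (x : Var) : Term 𝓕 → Set where
  var : x ∈Var var x
  fun : ∀ {f ts} → Any (x ∈Var_) ts → x ∈Var fun f ts

-- Substitutions need not have finite domain.  On any given term, or pair of
-- terms, only finitely many values matter, so the rewrite relation is the same.
Substitution : Signature → Set
Substitution 𝓕 = Var → Term 𝓕

module _ {𝓕 : Signature} where

  infixl 8 _⟨_⟩ _⟨_⟩*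

  mutual
    _⟨_⟩ : Term 𝓕 → Substitution 𝓕 → Term 𝓕
    var x    ⟨ σ ⟩ = σ x
    fun f ts ⟨ σ ⟩ = fun f (ts ⟨ σ ⟩*)

    _⟨_⟩* : ∀ {n} → Vec (Term 𝓕) n → Substitution 𝓕 → Vec (Term 𝓕) n
    []       ⟨ σ ⟩* = []
    (t ∷ ts) ⟨ σ ⟩* = t ⟨ σ ⟩ ∷ ts ⟨ σ ⟩*

  rename : Var ↔ Var → Substitution 𝓕
  rename π = var ∘ Inverse.to π

-- A possibly infinite set of pairs of terms.  Equations and rules share this
-- type; IsTRS singles out the sets of rewrite rules.
ES : Signature → Set₁
ES 𝓕 = Rel (Term 𝓕) 0ℓ

-- In the context f(ts) with hole at position i, the i-th entry of ts is
-- overwritten and hence irrelevant.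
data Step {𝓕 : Signature} (R : ES 𝓕) : Rel (Term 𝓕) 0ℓ where
  rule : ∀ {ℓ r} → R ℓ r → (σ : Substitution 𝓕) → Step R (ℓ ⟨ σ ⟩) (r ⟨ σ ⟩)
  arg  : ∀ f (ts : Vec (Term 𝓕) (arity 𝓕 f)) (i : Fin (arity 𝓕 f)) {s t} →
         Step R s t → Step R (fun f (ts [ i ]≔ s)) (fun f (ts [ i ]≔ t))

Terminating : {A : Set} → Rel A 0ℓ → Set
Terminating _⟶_ = ¬ ∃ (InfiniteDescendingSequence (flip _⟶_))

Normalizes : {A : Set} → Rel A 0ℓ → Rel A 0ℓ
Normalizes _⟶_ a b = Star _⟶_ a b × IsNormalForm _⟶_ b

module _ {𝓕 : Signature} where

  IsVariable : Term 𝓕 → Set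
  IsVariable t = ∃[ x ] t ≡ var x

  IsTRS : ES 𝓕 → Set
  IsTRS R = ∀ {ℓ r} → R ℓ r → ¬ IsVariable ℓ × (∀ {x} → x ∈Var r → x ∈Var ℓ)

  VariablePreserving : ES 𝓕 → Set
  VariablePreserving B =
    ∀ {ℓ r} → B ℓ r → (∀ {x} → x ∈Var ℓ → x ∈Var r) × (∀ {x} → x ∈Var r → x ∈Var ℓ)

  Conversion : ES 𝓕 → Rel (Term 𝓕) 0ℓ
  Conversion E = EqClosure (Step E)

  StepModulo : ES 𝓕 → ES 𝓕 → Rel (Term 𝓕) 0ℓ
  StepModulo B R = Conversion B ⨾ Step R ⨾ Conversion B

  _∖⟨_,_⟩ : ES 𝓕 → Term 𝓕 → Term 𝓕 → ES 𝓕
  (R ∖⟨ ℓ , r ⟩) ℓ′ r′ = R ℓ′ r′ × (ℓ′ , r′) ≢ (ℓ , r)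

  LeftReduced : ES 𝓕 → Set
  LeftReduced R = ∀ {ℓ r} → R ℓ r → IsNormalForm (Step (R ∖⟨ ℓ , r ⟩)) ℓ

  MapRight : (Term 𝓕 → Term 𝓕) → ES 𝓕 → ES 𝓕
  MapRight nf R ℓ r′ = ∃[ r ] R ℓ r × r′ ≡ nf r

  module _ (B : ES 𝓕) where

    TerminatingModulo : ES 𝓕 → Set
    TerminatingModulo R = Terminating (StepModulo B R)

    ChurchRosserModulo : ES 𝓕 → Set
    ChurchRosserModulo R =
      Conversion (R ∪ B) ⇒ Star (Step R) ⨾ Conversion B ⨾ flip (Star (Step R))

    CompleteModulo : ES 𝓕 → Set
    CompleteModulo R = TerminatingModulo R × ChurchRosserModulo R

    NormalizationEquivalentModulo : Rel (ES 𝓕) 0ℓ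
    NormalizationEquivalentModulo R S =
      (Normalizes (Step R) ⨾ Conversion B) ⇔ (Normalizes (Step S) ⨾ Conversion B)

    ConversionEquivalentModulo : Rel (ES 𝓕) 0ℓ
    ConversionEquivalentModulo R S = Conversion (R ∪ B) ⇔ Conversion (S ∪ B)

    RightReducedModulo : ES 𝓕 → Set
    RightReducedModulo R = ∀ {ℓ r} → R ℓ r → IsNormalForm (StepModulo B R) r

    CanonicalModulo : ES 𝓕 → Set
    CanonicalModulo R = CompleteModulo R × LeftReduced R × RightReducedModulo R

    RightEquivalentVariants : Rel (Term 𝓕 × Term 𝓕) 0ℓ
    RightEquivalentVariants (ℓ , r) (ℓ′ , r′) =
      Σ[ π ∈ Var ↔ Var ]
        ℓ ⟨ rename π ⟩ ≡ ℓ′ × Conversion B (r ⟨ rename π ⟩) r′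

    -- The subset of representatives is not determined by T, so "U is such a
    -- subset" is expressed as a relation between T and U.
    record IsRepresentativeSubset (T U : ES 𝓕) : Set where
      field
        subset : U ⇒ T
        exists : ∀ {ℓ r} → T ℓ r →
                 ∃[ ℓ′ ] ∃[ r′ ] U ℓ′ r′ × RightEquivalentVariants (ℓ , r) (ℓ′ , r′)
        unique : ∀ {ℓ r ℓ′ r′} → U ℓ r → U ℓ′ r′ →
                 RightEquivalentVariants (ℓ , r) (ℓ′ , r′) → (ℓ , r) ≡ (ℓ′ , r′)

    -- Ṙ depends on the choice of the normal forms r↓ (the function nf) and of
    -- the representatives; IsDot R Ṙ says that Ṙ arises from some such choice.
    IsDot : ES 𝓕 → ES 𝓕 → Set
    IsDot R Ṙ =
      Σ[ nf ∈ (Term 𝓕 → Term 𝓕) ]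
        (∀ t → Normalizes (StepModulo B R) t (nf t)) ×
        IsRepresentativeSubset (MapRight nf R) Ṙ

  -- Turns Ṙ into R̈.
  LeftReduce : ES 𝓕 → ES 𝓕
  LeftReduce Ṙ ℓ r = Ṙ ℓ r × IsNormalForm (Step (Ṙ ∖⟨ ℓ , r ⟩)) ℓ

{-# OPTIONS --safe #-}
-- Every step of R̈ is a nonempty sequence of R/B-steps, so R̈ is terminating
-- modulo B and contained in the conversions of R ∪ B.  Conversely every
-- R̈-normal form is an R-normal form: among the rules of Ṙ matching inside a
-- given term, one whose left-hand side is minimal for encompassment survives in
-- R̈, because a rule with a literally similar left-hand side has, by the
-- Church–Rosser property, a B-equivalent right-hand side, and so is the same
-- representative.  Hence convertible terms are R̈-reduced to R-normal forms,
-- which are B-equivalent since R is Church–Rosser modulo B; all the claims follow.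
module Submission where

open import Level using (0ℓ)
open import Axiom.ExcludedMiddle using (ExcludedMiddle)
open import Data.Empty using (⊥-elim)
open import Data.Fin.Base using (zero; suc)
open import Data.List.Base using (List; []; _∷_; _++_; map)
open import Data.List.Membership.Propositional using (_∈_)
open import Data.List.Membership.Propositional.Properties using (∈-++⁺ˡ; ∈-++⁺ʳ; ∈-++⁻)
open import Data.List.Properties using (map-++)
open import Data.List.Relation.Unary.Any using (here; there)
open import Data.Nat.Base using (ℕ; zero; suc; _+_; _≤_; _<_; z≤n; s≤s)
open import Data.Nat.Induction using (<-wellFounded)
open import Data.Nat.Properties using (_≟_; ≤-refl; ≤-trans; m≤m+n; m≤n+m; m≤n⇒m≤1+n; m≤n⇒m<n∨m≡n; +-mono-≤; +-mono-<-≤; +-mono-≤-<)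
open import Data.Product.Base using (_×_; _,_; ∃-syntax; proj₁; proj₂)
open import Data.Product.Relation.Binary.Lex.Strict using (×-Lex; ×-wellFounded)
open import Data.Sum.Base using (_⊎_; inj₁; inj₂; [_,_]′)
open import Data.Vec.Base using (Vec; []; _∷_; _[_]≔_)
open import Data.Vec.Relation.Unary.Any using (Any; here; there)
open import Function.Base using (_∘_; flip; _on_; id)
open import Function.Bundles using (_↔_; Injection; Inverse; mk↔ₛ′)
open import Function.Construct.Composition using (_↔-∘_)
open import Function.Construct.Identity using (↔-id)
open import Function.Properties.Inverse using (↔⇒↣)
open import Induction.InfiniteDescent using (descent∧wf⇒empty)
open import Induction.WellFounded using (WellFounded; Acc; acc; module Subrelation)
open import Relation.Binary.Construct.Closure.Equivalence as EqC using (EqClosure)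
open import Relation.Binary.Construct.Closure.ReflexiveTransitive as Star using (Star; ε; _◅_; _◅◅_)
open import Relation.Binary.Construct.Closure.Symmetric as Sym using (fwd; bwd)
open import Relation.Binary.Construct.Closure.Transitive using (TransClosure; [_]; _∷_; _∷ʳ_; wellFounded)
open import Relation.Binary.Construct.Composition using () renaming (_;_ to _⨾_)
open import Relation.Binary.Construct.On as On using ()
open import Relation.Binary.Construct.Union using (_∪_)
open import Relation.Binary.Core using (Rel; _⇒_)
open import Relation.Binary.PropositionalEquality using (_≡_; _≢_; refl; sym; trans; cong; cong₂; subst; subst₂; module ≡-Reasoning)
open import Relation.Binary.Rewriting using (IsNormalForm)
open import Relation.Nullary.Decidable.Core using (yes; no)
open import Relation.Nullary.Negation.Core using (¬_; contradiction)
open import Defs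

-- Abstract rewriting

module _ {A : Set} where

  flip-TransClosure : {P : Rel A 0ℓ} → flip (TransClosure P) ⇒ TransClosure (flip P)
  flip-TransClosure [ x ]    = [ x ]
  flip-TransClosure (x ∷ xs) = flip-TransClosure xs ∷ʳ x

  infixr 5 _◅⁺_

  _◅⁺_ : {P : Rel A 0ℓ} {a b c : A} → P a b → Star P b c → TransClosure P a c
  x ◅⁺ ε        = [ x ]
  x ◅⁺ (y ◅ ys) = x ∷ (y ◅⁺ ys)

  TransClosure⇒Star : {P : Rel A 0ℓ} → TransClosure P ⇒ Star P
  TransClosure⇒Star [ x ]    = x ◅ ε
  TransClosure⇒Star (x ∷ xs) = x ◅ TransClosure⇒Star xs

  Star-from-normalForm : {P : Rel A 0ℓ} {a b : A} → IsNormalForm P a → Star P a b → a ≡ b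
  Star-from-normalForm nf ε       = refl
  Star-from-normalForm nf (x ◅ _) = ⊥-elim (nf (_ , x))

  -- The values of an infinite sequence would form a nonempty set without a minimal element.
  wellFounded⇒terminating : {P : Rel A 0ℓ} → WellFounded (flip P) → Terminating P
  wellFounded⇒terminating wf (f , decreasing) =
    descent∧wf⇒empty {P = λ a → ∃[ n ] f n ≡ a}
      (λ { (n , refl) → f (suc n) , decreasing n , suc n , refl }) wf (f 0) (0 , refl)

  module _ (em : ExcludedMiddle 0ℓ) {P : Rel A 0ℓ} where

    -- Dec of an existential yields an actual successor, so excluded middle also
    -- supplies the dependent choice needed to build the infinite sequence.
    terminating⇒wellFounded : Terminating P → WellFounded (flip P)
    terminating⇒wellFounded term a with em {Acc (flip P) a}
    ... | yes a-acc = a-acc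
    ... | no ¬acc   = ⊥-elim (term (proj₁ ∘ walk , λ n → proj₁ (proj₂ (next (walk n)))))
      where
      Bad : Set
      Bad = ∃[ b ] ¬ Acc (flip P) b

      next : (b : Bad) → ∃[ c ] P (proj₁ b) c × ¬ Acc (flip P) c
      next (b , ¬b-acc) with em {∃[ c ] P b c × ¬ Acc (flip P) c}
      ... | yes found = found
      ... | no ¬found = ⊥-elim (¬b-acc (acc λ {c} b→c → accessible c b→c))
        where
        accessible : ∀ c → P b c → Acc (flip P) c
        accessible c b→c with em {Acc (flip P) c}
        ... | yes c-acc = c-acc
        ... | no ¬c-acc = ⊥-elim (¬found (c , b→c , ¬c-acc))

      walk : ℕ → Bad
      walk zero    = a , ¬acc
      walk (suc n) = let c , _ , ¬c-acc = next (walk n) in c , ¬c-acc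

    -- By well-founded recursion; excluded middle decides whether an element is normal or has a
    -- successor.
    normalizing : WellFounded (flip P) → ∀ a → ∃[ b ] Normalizes P a b
    normalizing wf a = go a (wf a)
      where
      go : ∀ a → Acc (flip P) a → ∃[ b ] Normalizes P a b
      go a (acc rs) with em {∃[ b ] P a b}
      ... | no  normal    = a , ε , normal
      ... | yes (b , a→b) = let c , b→*c , c-nf = go b (rs a→b) in c , a→b ◅ b→*c , c-nf

-- Injective maps on finite sets of variables

InjectiveOn : List Var → (Var → Var) → Set
InjectiveOn xs f = ∀ {x y} → x ∈ xs → y ∈ xs → f x ≡ f y → x ≡ y

occurrences : Var → List Var → ℕ
occurrences x []       = 0
occurrences x (y ∷ ys) with x ≟ y
... | yes _ = suc (occurrences x ys)
... | no  _ = occurrences x ys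

-- Identifying variables increases this number, so it can replace the (decreasing)
-- number of distinct variables in a well-founded measure.
coincidences : List Var → ℕ
coincidences []       = 0
coincidences (x ∷ xs) = occurrences x xs + coincidences xs

module _ (f : Var → Var) where

  occurrences-map-≤ : ∀ x ys → occurrences x ys ≤ occurrences (f x) (map f ys)
  occurrences-map-≤ x []       = z≤n
  occurrences-map-≤ x (y ∷ ys) with x ≟ y | f x ≟ f y
  ... | yes _    | yes _     = s≤s (occurrences-map-≤ x ys)
  ... | yes refl | no  fx≢fx = ⊥-elim (fx≢fx refl)
  ... | no  _    | yes _     = m≤n⇒m≤1+n (occurrences-map-≤ x ys)
  ... | no  _    | no  _     = occurrences-map-≤ x ys

  -- Occurrences of `x` become occurrences of `f x`, so the count never drops; it rises as soon as
  -- `ys` contains another variable with the same image.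
  occurrences-map-< : ∀ x ys → (∀ {y} → y ∈ ys → f x ≡ f y → x ≡ y) ⊎
                               occurrences x ys < occurrences (f x) (map f ys)
  occurrences-map-< x []       = inj₁ λ ()
  occurrences-map-< x (y ∷ ys) with x ≟ y | f x ≟ f y | occurrences-map-< x ys
  ... | yes refl | no  fx≢fx | _        = ⊥-elim (fx≢fx refl)
  ... | yes refl | yes _     | inj₂ lt  = inj₂ (s≤s lt)
  ... | yes refl | yes _     | inj₁ inj = inj₁ λ { (here refl) _ → refl ; (there y∈) → inj y∈ }
  ... | no  _    | yes _     | _        = inj₂ (s≤s (occurrences-map-≤ x ys))
  ... | no  _    | no  _     | inj₂ lt  = inj₂ lt
  ... | no  _    | no  fx≢fy | inj₁ inj =
    inj₁ λ { (here refl) fx≡fy → ⊥-elim (fx≢fy fx≡fy) ; (there y∈) → inj y∈ }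

  coincidences-map-≤ : ∀ xs → coincidences xs ≤ coincidences (map f xs)
  coincidences-map-≤ []       = z≤n
  coincidences-map-≤ (x ∷ xs) = +-mono-≤ (occurrences-map-≤ x xs) (coincidences-map-≤ xs)

  coincidences-map-< : ∀ xs → InjectiveOn xs f ⊎ coincidences xs < coincidences (map f xs)
  coincidences-map-< []       = inj₁ λ ()
  coincidences-map-< (x ∷ xs) with occurrences-map-< x xs | coincidences-map-< xs
  ... | inj₂ lt  | _        = inj₂ (+-mono-<-≤ lt (coincidences-map-≤ xs))
  ... | inj₁ _   | inj₂ lt  = inj₂ (+-mono-≤-< (occurrences-map-≤ x xs) lt)
  ... | inj₁ inj | inj₁ rec = inj₁ λ
    { (here refl) (here refl) _  → refl
    ; (here refl) (there y∈)  eq → inj y∈ eq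
    ; (there x∈)  (here refl) eq → sym (inj x∈ (sym eq))
    ; (there x∈)  (there y∈)  eq → rec x∈ y∈ eq
    }

-- Transpositions and permutations of variables

module _ (a b : Var) where

  swap : Var → Var
  swap x with x ≟ a | x ≟ b
  ... | yes _ | _     = b
  ... | no  _ | yes _ = a
  ... | no  _ | no  _ = x

  swap-left : swap a ≡ b
  swap-left with a ≟ a | a ≟ b
  ... | yes _  | _ = refl
  ... | no a≢a | _ = ⊥-elim (a≢a refl)

  swap-right : swap b ≡ a
  swap-right with b ≟ a | b ≟ b
  -- If `a` and `b` coincide, the first clause of `swap` applies and returns `b`.
  ... | yes b≡a | _      = b≡a
  ... | no _    | yes _  = refl
  ... | no _    | no b≢b = ⊥-elim (b≢b refl)

  swap-other : ∀ {x} → x ≢ a → x ≢ b → swap x ≡ x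
  swap-other {x} x≢a x≢b with x ≟ a | x ≟ b
  ... | yes x≡a | _       = ⊥-elim (x≢a x≡a)
  ... | no  _   | yes x≡b = ⊥-elim (x≢b x≡b)
  ... | no  _   | no  _   = refl

  swap-involutive : ∀ x → swap (swap x) ≡ x
  swap-involutive x with x ≟ a | x ≟ b
  ... | yes refl | _        = swap-right
  ... | no  _    | yes refl = swap-left
  ... | no  x≢a  | no  x≢b  = swap-other x≢a x≢b

  transposition : Var ↔ Var
  transposition = mk↔ₛ′ swap swap swap-involutive swap-involutive

-- A new value f x is attained by composing with the transposition of π x and f x.
extend-to-bijection : ∀ (f : Var → Var) xs → InjectiveOn xs f →
                      ∃[ π ] (∀ {x} → x ∈ xs → Inverse.to π x ≡ f x)
extend-to-bijection f []       inj = ↔-id _ , λ ()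
extend-to-bijection f (x ∷ xs) inj
  with extend-to-bijection f xs (λ x∈ y∈ → inj (there x∈) (there y∈))
... | π , π≗f = transposition (to x) (f x) ↔-∘ π , λ
    { (here refl) → swap-left (to x) (f x)
    ; (there y∈)  → agrees y∈
    }
  where
  open Injection (↔⇒↣ π) using (to; injective)
  agrees : ∀ {y} → y ∈ xs → swap (to x) (f x) (to y) ≡ f y
  agrees {y} y∈ with y ≟ x
  ... | yes refl = swap-left (to x) (f x)
  -- The transposition fixes `to y`: it differs from `to x` since `π` is injective, and from `f x`
  -- since it equals `f y` and `f` is injective on the list.
  ... | no  y≢x  = trans
    (swap-other (to x) (f x) (y≢x ∘ injective)
      (λ πy≡fx → y≢x (inj (there y∈) (here refl) (trans (sym (π≗f y∈)) πy≡fx))))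
    (π≗f y∈)

-- Terms and substitutions

module _ {𝓕 : Signature} where

  mutual
    -- Repetitions are kept, because `coincidences` counts pairs of positions holding the same
    -- variable.
    vars : Term 𝓕 → List Var
    vars (var x)    = x ∷ []
    vars (fun f ts) = vars* ts

    vars* : ∀ {n} → Vec (Term 𝓕) n → List Var
    vars* []       = []
    vars* (t ∷ ts) = vars t ++ vars* ts

  mutual
    -- Variables count 0 and constants 1, so a substitution preserves the count only if it sends the
    -- variables of the term to variables.
    symbolCount : Term 𝓕 → ℕ
    symbolCount (var x)    = 0
    symbolCount (fun f ts) = suc (symbolCount* ts)

    symbolCount* : ∀ {n} → Vec (Term 𝓕) n → ℕ
    symbolCount* []       = 0
    symbolCount* (t ∷ ts) = symbolCount t + symbolCount* ts

  mutual
    ⟨⟩-local : ∀ {σ τ : Substitution 𝓕} t → (∀ {x} → x ∈ vars t → σ x ≡ τ x) → t ⟨ σ ⟩ ≡ t ⟨ τ ⟩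
    ⟨⟩-local (var x)    eq = eq (here refl)
    ⟨⟩-local (fun f ts) eq = cong (fun f) (⟨⟩*-local ts eq)

    ⟨⟩*-local : ∀ {σ τ : Substitution 𝓕} {n} (ts : Vec (Term 𝓕) n) →
                (∀ {x} → x ∈ vars* ts → σ x ≡ τ x) → ts ⟨ σ ⟩* ≡ ts ⟨ τ ⟩*
    ⟨⟩*-local []       eq = refl
    ⟨⟩*-local (t ∷ ts) eq = cong₂ _∷_ (⟨⟩-local t (eq ∘ ∈-++⁺ˡ)) (⟨⟩*-local ts (eq ∘ ∈-++⁺ʳ (vars t)))

  mutual
    ⟨var⟩ : ∀ (t : Term 𝓕) → t ⟨ var ⟩ ≡ t
    ⟨var⟩ (var x)    = refl
    ⟨var⟩ (fun f ts) = cong (fun f) (⟨var⟩* ts)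

    ⟨var⟩* : ∀ {n} (ts : Vec (Term 𝓕) n) → ts ⟨ var ⟩* ≡ ts
    ⟨var⟩* []       = refl
    ⟨var⟩* (t ∷ ts) = cong₂ _∷_ (⟨var⟩ t) (⟨var⟩* ts)

  mutual
    ⟨⟩-∘ : ∀ (t : Term 𝓕) σ τ → t ⟨ σ ⟩ ⟨ τ ⟩ ≡ t ⟨ (λ x → σ x ⟨ τ ⟩) ⟩
    ⟨⟩-∘ (var x)    σ τ = refl
    ⟨⟩-∘ (fun f ts) σ τ = cong (fun f) (⟨⟩*-∘ ts σ τ)

    ⟨⟩*-∘ : ∀ {n} (ts : Vec (Term 𝓕) n) σ τ → ts ⟨ σ ⟩* ⟨ τ ⟩* ≡ ts ⟨ (λ x → σ x ⟨ τ ⟩) ⟩*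
    ⟨⟩*-∘ []       σ τ = refl
    ⟨⟩*-∘ (t ∷ ts) σ τ = cong₂ _∷_ (⟨⟩-∘ t σ τ) (⟨⟩*-∘ ts σ τ)

  ⟨⟩*-≔ : ∀ {n} (ts : Vec (Term 𝓕) n) i s σ → (ts [ i ]≔ s) ⟨ σ ⟩* ≡ ts ⟨ σ ⟩* [ i ]≔ (s ⟨ σ ⟩)
  ⟨⟩*-≔ (t ∷ ts) zero    s σ = refl
  ⟨⟩*-≔ (t ∷ ts) (suc i) s σ = cong (t ⟨ σ ⟩ ∷_) (⟨⟩*-≔ ts i s σ)

  renameBack : Var ↔ Var → Substitution 𝓕
  renameBack π = var ∘ Inverse.from π

  rename-renameBack : ∀ (t : Term 𝓕) π → t ⟨ rename π ⟩ ⟨ renameBack π ⟩ ≡ t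
  rename-renameBack t π = begin
    t ⟨ rename π ⟩ ⟨ renameBack π ⟩                    ≡⟨ ⟨⟩-∘ t (rename π) (renameBack π) ⟩
    t ⟨ (λ x → var (Inverse.from π (Inverse.to π x))) ⟩ ≡⟨ ⟨⟩-local t (λ {x} _ → cong var (Inverse.strictlyInverseʳ π x)) ⟩
    t ⟨ var ⟩                                          ≡⟨ ⟨var⟩ t ⟩
    t                                                  ∎
    where open ≡-Reasoning

  mutual
    vars-⟨var∘⟩ : ∀ f (t : Term 𝓕) → vars (t ⟨ var ∘ f ⟩) ≡ map f (vars t)
    vars-⟨var∘⟩ f (var x)    = refl
    vars-⟨var∘⟩ f (fun g ts) = vars*-⟨var∘⟩ f ts

    vars*-⟨var∘⟩ : ∀ f {n} (ts : Vec (Term 𝓕) n) → vars* (ts ⟨ var ∘ f ⟩*) ≡ map f (vars* ts)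
    vars*-⟨var∘⟩ f []       = refl
    vars*-⟨var∘⟩ f (t ∷ ts) =
      trans (cong₂ _++_ (vars-⟨var∘⟩ f t) (vars*-⟨var∘⟩ f ts)) (sym (map-++ f (vars t) (vars* ts)))

  mutual
    symbolCount-⟨⟩-≤ : ∀ (t : Term 𝓕) σ → symbolCount t ≤ symbolCount (t ⟨ σ ⟩)
    symbolCount-⟨⟩-≤ (var x)    σ = z≤n
    symbolCount-⟨⟩-≤ (fun f ts) σ = s≤s (symbolCount*-⟨⟩-≤ ts σ)

    symbolCount*-⟨⟩-≤ : ∀ {n} (ts : Vec (Term 𝓕) n) σ → symbolCount* ts ≤ symbolCount* (ts ⟨ σ ⟩*)
    symbolCount*-⟨⟩-≤ []       σ = z≤n
    symbolCount*-⟨⟩-≤ (t ∷ ts) σ = +-mono-≤ (symbolCount-⟨⟩-≤ t σ) (symbolCount*-⟨⟩-≤ ts σ)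

  mutual
    symbolCount-⟨⟩-< : ∀ (t : Term 𝓕) σ → (∀ {x} → x ∈ vars t → IsVariable (σ x)) ⊎
                                          symbolCount t < symbolCount (t ⟨ σ ⟩)
    symbolCount-⟨⟩-< (var x) σ with σ x in eq
    ... | var y   = inj₁ λ { (here refl) → y , eq }
    ... | fun _ _ = inj₂ (s≤s z≤n)
    symbolCount-⟨⟩-< (fun f ts) σ with symbolCount*-⟨⟩-< ts σ
    ... | inj₁ vs = inj₁ vs
    ... | inj₂ lt = inj₂ (s≤s lt)

    symbolCount*-⟨⟩-< : ∀ {n} (ts : Vec (Term 𝓕) n) σ →
                        (∀ {x} → x ∈ vars* ts → IsVariable (σ x)) ⊎
                        symbolCount* ts < symbolCount* (ts ⟨ σ ⟩*)
    symbolCount*-⟨⟩-< []       σ = inj₁ λ ()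
    symbolCount*-⟨⟩-< (t ∷ ts) σ with symbolCount-⟨⟩-< t σ | symbolCount*-⟨⟩-< ts σ
    ... | inj₂ lt | _       = inj₂ (+-mono-<-≤ lt (symbolCount*-⟨⟩-≤ ts σ))
    ... | inj₁ _  | inj₂ lt = inj₂ (+-mono-≤-< (symbolCount-⟨⟩-≤ t σ) lt)
    ... | inj₁ vs | inj₁ ws = inj₁ ([ vs , ws ]′ ∘ ∈-++⁻ (vars t))

  symbolCount*-≔ : ∀ {n} (ts : Vec (Term 𝓕) n) i s → symbolCount s ≤ symbolCount* (ts [ i ]≔ s)
  symbolCount*-≔ (t ∷ ts) zero    s = m≤m+n _ _
  symbolCount*-≔ (t ∷ ts) (suc i) s = ≤-trans (symbolCount*-≔ ts i s) (m≤n+m _ (symbolCount t))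

  -- The value 0 is junk.
  variableName : Term 𝓕 → Var
  variableName (var x)   = x
  variableName (fun _ _) = 0

  variableName-correct : ∀ {t} → IsVariable t → t ≡ var (variableName t)
  variableName-correct (_ , refl) = refl

  -- A measure compatible with encompassment: it decreases when passing to a
  -- pattern of a subterm, unless that pattern is a variant of the whole term.
  measure : Term 𝓕 → ℕ × ℕ
  measure t = symbolCount t , coincidences (vars t)

  infix 4 _≺_

  _≺_ : Rel (Term 𝓕) 0ℓ
  _≺_ = ×-Lex _≡_ _<_ _<_ on measure

  ≺-wellFounded : WellFounded _≺_
  ≺-wellFounded = On.wellFounded measure (×-wellFounded <-wellFounded <-wellFounded)

  -- Equal symbol counts force `σ` to send variables of `ℓ` to variables. If the coincidences do not
  -- increase either, this map is injective on `vars ℓ` and extends to a permutation.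
  variant-or-≺ : ∀ ℓ (σ : Substitution 𝓕) → (∃[ π ] ℓ ⟨ rename π ⟩ ≡ ℓ ⟨ σ ⟩) ⊎ ℓ ≺ ℓ ⟨ σ ⟩
  variant-or-≺ ℓ σ with m≤n⇒m<n∨m≡n (symbolCount-⟨⟩-≤ ℓ σ) | symbolCount-⟨⟩-< ℓ σ
  ... | inj₁ lt | _       = inj₂ (inj₁ lt)
  ... | inj₂ _  | inj₂ lt = inj₂ (inj₁ lt)
  ... | inj₂ eq | inj₁ σ-vars with coincidences-map-< (variableName ∘ σ) (vars ℓ)
  ...   | inj₂ lt  = inj₂ (inj₂ (eq , subst (λ xs → coincidences (vars ℓ) < coincidences xs) vars-ℓσ lt))
    where
    vars-ℓσ : map (variableName ∘ σ) (vars ℓ) ≡ vars (ℓ ⟨ σ ⟩)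
    vars-ℓσ = trans (sym (vars-⟨var∘⟩ _ ℓ))
                    (cong vars (⟨⟩-local ℓ (sym ∘ variableName-correct ∘ σ-vars)))
  ...   | inj₁ inj = let π , π≗ = extend-to-bijection (variableName ∘ σ) (vars ℓ) inj in
    inj₁ (π , ⟨⟩-local ℓ (λ x∈ → trans (cong var (π≗ x∈)) (sym (variableName-correct (σ-vars x∈)))))

-- Rewrite relations

  record IsRewriteRelation (P : Rel (Term 𝓕) 0ℓ) : Set where
    field
      substitutive : ∀ σ {s t} → P s t → P (s ⟨ σ ⟩) (t ⟨ σ ⟩)
      contextual   : ∀ f ts i {s t} → P s t → P (fun f (ts [ i ]≔ s)) (fun f (ts [ i ]≔ t))

  open IsRewriteRelation

  -- Serves as the induction principle for rewrite steps: only the rules remain to be checked.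
  Step-least : ∀ {R : ES 𝓕} {P} → IsRewriteRelation P → R ⇒ P → Step R ⇒ P
  Step-least P-rew R⇒P (rule Rℓr σ)   = substitutive P-rew σ (R⇒P Rℓr)
  Step-least P-rew R⇒P (arg f ts i x) = contextual P-rew f ts i (Step-least P-rew R⇒P x)

  Step-isRewriteRelation : ∀ (R : ES 𝓕) → IsRewriteRelation (Step R)
  Step-isRewriteRelation R = record { substitutive = subs ; contextual = arg }
    where
    subs : ∀ τ {s t} → Step R s t → Step R (s ⟨ τ ⟩) (t ⟨ τ ⟩)
    subs τ (rule {ℓ} {r} Rℓr σ) =
      subst₂ (Step R) (sym (⟨⟩-∘ ℓ σ τ)) (sym (⟨⟩-∘ r σ τ)) (rule Rℓr _)
    subs τ (arg f ts i {s} {t} x) =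
      subst₂ (Step R) (cong (fun f) (sym (⟨⟩*-≔ ts i s τ))) (cong (fun f) (sym (⟨⟩*-≔ ts i t τ)))
        (arg f (ts ⟨ τ ⟩*) i (subs τ x))

  flip-isRewriteRelation : ∀ {P} → IsRewriteRelation P → IsRewriteRelation (flip P)
  flip-isRewriteRelation P-rew = record
    { substitutive = λ σ → substitutive P-rew σ ; contextual = λ f ts i → contextual P-rew f ts i }

  EqClosure-isRewriteRelation : ∀ {P} → IsRewriteRelation P → IsRewriteRelation (EqClosure P)
  EqClosure-isRewriteRelation P-rew = record
    { substitutive = λ σ → EqC.gmap _⟨ σ ⟩ (substitutive P-rew σ)
    ; contextual   = λ f ts i → EqC.gmap (λ s → fun f (ts [ i ]≔ s)) (contextual P-rew f ts i)
    }

  ⨾-isRewriteRelation : ∀ {P Q} → IsRewriteRelation P → IsRewriteRelation Q → IsRewriteRelation (P ⨾ Q)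
  ⨾-isRewriteRelation P-rew Q-rew = record
    { substitutive = λ { σ (_ , p , q) → _ , substitutive P-rew σ p , substitutive Q-rew σ q }
    ; contextual   = λ { f ts i (_ , p , q) → _ , contextual P-rew f ts i p , contextual Q-rew f ts i q }
    }

  TransClosure-isRewriteRelation : ∀ {P} → IsRewriteRelation P → IsRewriteRelation (TransClosure P)
  TransClosure-isRewriteRelation {P} P-rew = record { substitutive = subs ; contextual = ctxt }
    where
    subs : ∀ σ {s t} → TransClosure P s t → TransClosure P (s ⟨ σ ⟩) (t ⟨ σ ⟩)
    subs σ [ x ]    = [ substitutive P-rew σ x ]
    subs σ (x ∷ xs) = substitutive P-rew σ x ∷ subs σ xs

    ctxt : ∀ f ts i {s t} → TransClosure P s t → TransClosure P (fun f (ts [ i ]≔ s)) (fun f (ts [ i ]≔ t))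
    ctxt f ts i [ x ]    = [ contextual P-rew f ts i x ]
    ctxt f ts i (x ∷ xs) = contextual P-rew f ts i x ∷ ctxt f ts i xs

  Conversion-isRewriteRelation : ∀ (E : ES 𝓕) → IsRewriteRelation (Conversion E)
  Conversion-isRewriteRelation E = EqClosure-isRewriteRelation (Step-isRewriteRelation E)

  StepModulo-isRewriteRelation : ∀ (B R : ES 𝓕) → IsRewriteRelation (StepModulo B R)
  StepModulo-isRewriteRelation B R =
    ⨾-isRewriteRelation (Conversion-isRewriteRelation B)
      (⨾-isRewriteRelation (Step-isRewriteRelation R) (Conversion-isRewriteRelation B))

  step : ∀ {R : ES 𝓕} → R ⇒ Step R
  step {R} Rℓr = subst₂ (Step R) (⟨var⟩ _) (⟨var⟩ _) (rule Rℓr var)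

  Step-mono : ∀ {R S : ES 𝓕} → R ⇒ S → Step R ⇒ Step S
  Step-mono R⇒S = Step-least (Step-isRewriteRelation _) (step ∘ R⇒S)

  Conversion-least : ∀ {E F : ES 𝓕} → E ⇒ Conversion F → Conversion E ⇒ Conversion F
  Conversion-least E⇒F = Step-least (Conversion-isRewriteRelation _) E⇒F EqC.⋆

  StepModulo⇒Conversion : ∀ {B R : ES 𝓕} → StepModulo B R ⇒ Conversion (R ∪ B)
  StepModulo⇒Conversion (_ , a~b , _ , b→c , c~d) =
    EqC.map (Step-mono inj₂) a~b ◅◅ fwd (Step-mono inj₁ b→c) ◅ EqC.map (Step-mono inj₂) c~d

  Star⇒Conversion : ∀ {R B : ES 𝓕} → Star (Step R) ⇒ Conversion (R ∪ B)
  Star⇒Conversion = Star.map (fwd ∘ Step-mono inj₁)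

  -- The outer conversions are absorbed into those flanking the first and last step, which exist
  -- because the sequence is nonempty.
  ~-⁺-~ : ∀ {B R : ES 𝓕} {s t u v} → Conversion B s t → TransClosure (StepModulo B R) t u → Conversion B u v →
          TransClosure (StepModulo B R) s v
  ~-⁺-~ a~b [ _ , b~c , _ , c→d , d~e ] e~f = [ _ , a~b ◅◅ b~c , _ , c→d , d~e ◅◅ e~f ]
  ~-⁺-~ a~b ((_ , b~c , c→d) ∷ ds)      e~f = (_ , a~b ◅◅ b~c , c→d) ∷ ~-⁺-~ ε ds e~f

  StepModulo-least : ∀ {B R S : ES 𝓕} → S ⇒ TransClosure (StepModulo B R) →
                     StepModulo B S ⇒ TransClosure (StepModulo B R)
  StepModulo-least {B} {R} S⇒ (_ , a~b , _ , b→c , c~d) =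
    ~-⁺-~ a~b (Step-least (TransClosure-isRewriteRelation (StepModulo-isRewriteRelation B R)) S⇒ b→c) c~d

  -- Reducibility, normal forms and redexes

  Reducible : ES 𝓕 → Term 𝓕 → Set
  Reducible R t = ∃[ u ] Step R t u

  Reducible-⟨⟩ : ∀ {R : ES 𝓕} {t} σ → Reducible R t → Reducible R (t ⟨ σ ⟩)
  Reducible-⟨⟩ σ (_ , x) = _ , substitutive (Step-isRewriteRelation _) σ x

  -- Every redex is an instance of a left-hand side, and reducibility is preserved by substitutions
  -- and contexts.
  Reducible-lhs : ∀ {R S : ES 𝓕} → (∀ {ℓ r} → R ℓ r → Reducible S ℓ) → ∀ {t} → Reducible R t → Reducible S t
  Reducible-lhs {R} {S} lhs (_ , t→u) = go t→u
    where
    go : ∀ {t u} → Step R t u → Reducible S t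
    go (rule Rℓr σ)   = Reducible-⟨⟩ σ (lhs Rℓr)
    go (arg f ts i x) = _ , arg f ts i (proj₂ (go x))

  normalForm-rename : ∀ {R : ES 𝓕} {t} π → IsNormalForm (Step R) t → IsNormalForm (Step R) (t ⟨ rename π ⟩)
  normalForm-rename {R} {t} π nf red =
    nf (subst (Reducible R) (rename-renameBack t π) (Reducible-⟨⟩ (renameBack π) red))

  normalForm-modulo : ∀ {B R : ES 𝓕} {t} → IsNormalForm (StepModulo B R) t → IsNormalForm (Step R) t
  normalForm-modulo nf (_ , x) = nf (_ , _ , ε , _ , x , ε)

  -- The two reductions given by the Church-Rosser property start at normal forms, so they are
  -- empty.
  normalForms-convertible : ∀ {B R : ES 𝓕} → ChurchRosserModulo B R → ∀ {s t} →
    IsNormalForm (Step R) s → IsNormalForm (Step R) t → Conversion (R ∪ B) s t → Conversion B s t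
  normalForms-convertible cr s-nf t-nf s↔t with cr s↔t
  ... | _ , s→* , _ , ~ , t→* with Star-from-normalForm s-nf s→* | Star-from-normalForm t-nf t→*
  ... | refl | refl = ~

  -- At the root, `ℓ` matches all of `t`; below the root it matches a proper subterm and so has
  -- fewer symbols than `t`. The last component carries a reduction of `ℓ` through the same
  -- substitution and context.
  redex : ∀ {S : ES 𝓕} {t u} → Step S t u →
          ∃[ ℓ ] ∃[ r ] S ℓ r × ((∃[ σ ] t ≡ ℓ ⟨ σ ⟩) ⊎ ℓ ≺ t) × (∀ {Q} → Reducible Q ℓ → Reducible Q t)
  redex (rule {ℓ} {r} Sℓr σ) = ℓ , r , Sℓr , inj₁ (σ , refl) , Reducible-⟨⟩ σ
  redex (arg f ts i {s} x) with redex x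
  ... | ℓ , r , Sℓr , at , lift = ℓ , r , Sℓr , inj₂ (inj₁ (s≤s (≤-trans (small at) (symbolCount*-≔ ts i s)))) ,
                                  λ red → _ , arg f ts i (proj₂ (lift red))
    where
    small : (∃[ σ ] s ≡ ℓ ⟨ σ ⟩) ⊎ ℓ ≺ s → symbolCount ℓ ≤ symbolCount s
    small (inj₁ (σ , refl))      = symbolCount-⟨⟩-≤ ℓ σ
    small (inj₂ (inj₁ lt))       = ≤-trans (m≤n⇒m≤1+n ≤-refl) lt
    small (inj₂ (inj₂ (eq , _))) = subst (symbolCount ℓ ≤_) eq ≤-refl

-- Variables of terms under rewriting

  infix 4 _⊇Var_

  _⊇Var_ : Rel (Term 𝓕) 0ℓ
  s ⊇Var t = ∀ {x} → x ∈Var t → x ∈Var s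

  mutual
    ∈Var-⟨⟩⁻ : ∀ {x} t {σ : Substitution 𝓕} → x ∈Var (t ⟨ σ ⟩) → ∃[ y ] y ∈Var t × x ∈Var σ y
    ∈Var-⟨⟩⁻ (var y)    x∈       = y , var , x∈
    ∈Var-⟨⟩⁻ (fun f ts) (fun x∈) = let y , y∈ , x∈σy = ∈Var-⟨⟩*⁻ ts x∈ in y , fun y∈ , x∈σy

    ∈Var-⟨⟩*⁻ : ∀ {x n} (ts : Vec (Term 𝓕) n) {σ : Substitution 𝓕} →
                Any (x ∈Var_) (ts ⟨ σ ⟩*) → ∃[ y ] Any (y ∈Var_) ts × x ∈Var σ y
    ∈Var-⟨⟩*⁻ (t ∷ ts) (here x∈)  = let y , y∈ , x∈σy = ∈Var-⟨⟩⁻ t x∈ in y , here y∈ , x∈σy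
    ∈Var-⟨⟩*⁻ (t ∷ ts) (there x∈) = let y , y∈ , x∈σy = ∈Var-⟨⟩*⁻ ts x∈ in y , there y∈ , x∈σy

  mutual
    ∈Var-⟨⟩⁺ : ∀ {x y t} {σ : Substitution 𝓕} → y ∈Var t → x ∈Var σ y → x ∈Var (t ⟨ σ ⟩)
    ∈Var-⟨⟩⁺ var      x∈ = x∈
    ∈Var-⟨⟩⁺ (fun y∈) x∈ = fun (∈Var-⟨⟩*⁺ y∈ x∈)

    ∈Var-⟨⟩*⁺ : ∀ {x y n} {ts : Vec (Term 𝓕) n} {σ : Substitution 𝓕} →
                Any (y ∈Var_) ts → x ∈Var σ y → Any (x ∈Var_) (ts ⟨ σ ⟩*)
    ∈Var-⟨⟩*⁺ (here y∈)  x∈ = here (∈Var-⟨⟩⁺ y∈ x∈)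
    ∈Var-⟨⟩*⁺ (there y∈) x∈ = there (∈Var-⟨⟩*⁺ y∈ x∈)

  Any-≔ : ∀ {P : Term 𝓕 → Set} {n} (ts : Vec (Term 𝓕) n) i {s t} →
          (P t → P s) → Any P (ts [ i ]≔ t) → Any P (ts [ i ]≔ s)
  Any-≔ (_ ∷ ts) zero    f (here p)   = here (f p)
  Any-≔ (_ ∷ ts) zero    f (there ps) = there ps
  Any-≔ (_ ∷ ts) (suc i) f (here p)   = here p
  Any-≔ (_ ∷ ts) (suc i) f (there ps) = there (Any-≔ ts i f ps)

  -- With `Step-least`, this reduces variable inclusion for steps to variable inclusion for rules.
  ⊇Var-isRewriteRelation : IsRewriteRelation _⊇Var_
  ⊇Var-isRewriteRelation = record
    { substitutive = λ σ {s} {t} s⊇t x∈ → let _ , y∈ , x∈σy = ∈Var-⟨⟩⁻ t x∈ in ∈Var-⟨⟩⁺ (s⊇t y∈) x∈σy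
    ; contextual   = λ { f ts i s⊇t (fun x∈) → fun (Any-≔ ts i s⊇t x∈) }
    }

  Conversion-⊇Var : ∀ {B : ES 𝓕} → VariablePreserving B → Conversion B ⇒ _⊇Var_
  Conversion-⊇Var {B} vp = Star.fold _⊇Var_ (λ x s⊇t → symStep x ∘ s⊇t) id
    where
    symStep : Sym.SymClosure (Step B) ⇒ _⊇Var_
    symStep (fwd x) = Step-least ⊇Var-isRewriteRelation (λ b → proj₂ (vp b)) x
    -- A backward step needs the other inclusion of `VariablePreserving`, hence the flipped
    -- relation.
    symStep (bwd x) = Step-least (flip-isRewriteRelation ⊇Var-isRewriteRelation) (λ b → proj₁ (vp b)) x

  StepModulo-⊇Var : ∀ {B R : ES 𝓕} → VariablePreserving B → IsTRS R → StepModulo B R ⇒ _⊇Var_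
  StepModulo-⊇Var vp trs (_ , a~b , _ , b→c , c~d) =
    Conversion-⊇Var vp a~b ∘ Step-least ⊇Var-isRewriteRelation (λ Rℓr → proj₂ (trs Rℓr)) b→c ∘ Conversion-⊇Var vp c~d

-- The systems Ṙ and R̈

module _ (em : ExcludedMiddle 0ℓ) {𝓕 : Signature} (B : ES 𝓕) (vp : VariablePreserving B)
         (R : ES 𝓕) (trs : IsTRS R) (complete : CompleteModulo B R)
         (Ṙ : ES 𝓕) (dot : IsDot B R Ṙ) where

  private
    R̈ : ES 𝓕
    R̈ = LeftReduce Ṙ

    cr : ChurchRosserModulo B R
    cr = proj₂ complete

    open IsRepresentativeSubset (proj₂ (proj₂ dot))

  -- The original rule gives the first step, and normalizing its right-hand side gives the rest.
  Ṙ⇒⁺ : Ṙ ⇒ TransClosure (StepModulo B R)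
  Ṙ⇒⁺ Ṙℓr with subset Ṙℓr
  ... | r₀ , Rℓr₀ , refl = (_ , ε , _ , step Rℓr₀ , ε) ◅⁺ proj₁ (proj₁ (proj₂ dot) r₀)

  Ṙ-rhs-normal : ∀ {ℓ r} → Ṙ ℓ r → IsNormalForm (StepModulo B R) r
  Ṙ-rhs-normal Ṙℓr with subset Ṙℓr
  ... | r₀ , _ , refl = proj₂ (proj₁ (proj₂ dot) r₀)

  -- Left-hand sides are unchanged, and normalizing a right-hand side introduces no variables.
  Ṙ-isTRS : IsTRS Ṙ
  Ṙ-isTRS Ṙℓr with subset Ṙℓr
  ... | r₀ , Rℓr₀ , refl = proj₁ (trs Rℓr₀) , proj₂ (trs Rℓr₀) ∘
    Star.fold _⊇Var_ (λ x s⊇t → StepModulo-⊇Var vp trs x ∘ s⊇t) id (proj₁ (proj₁ (proj₂ dot) r₀))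

  Ṙ⇒Conversion : Ṙ ⇒ Conversion (R ∪ B)
  Ṙ⇒Conversion = (StepModulo⇒Conversion Star.⋆) ∘ TransClosure⇒Star ∘ Ṙ⇒⁺

  -- The renamed `r` and `r′` are normal and convertible through `ℓ′`, hence B-equivalent. The rules
  -- are thus right-B-equivalent variants, and each class has a single representative.
  Ṙ-unique : ∀ {ℓ r ℓ′ r′} → Ṙ ℓ r → Ṙ ℓ′ r′ → ∀ π → ℓ ⟨ rename π ⟩ ≡ ℓ′ → (ℓ , r) ≡ (ℓ′ , r′)
  Ṙ-unique Ṙℓr Ṙℓ′r′ π refl = unique Ṙℓr Ṙℓ′r′ (π , refl ,
    normalForms-convertible cr
      (normalForm-rename π (normalForm-modulo (Ṙ-rhs-normal Ṙℓr)))
      (normalForm-modulo (Ṙ-rhs-normal Ṙℓ′r′))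
      (EqC.symmetric _ (substitutive (Conversion-isRewriteRelation _) (rename π) (Ṙ⇒Conversion Ṙℓr))
        ◅◅ Ṙ⇒Conversion Ṙℓ′r′))
    where open IsRewriteRelation

  -- Induction on `≺`. If the rule is not in `R̈`, another rule of `Ṙ` reduces `ℓ`. Its left-hand
  -- side is either smaller, so that its reduction lifts to `ℓ`, or a variant of `ℓ`, which
  -- `Ṙ-unique` excludes.
  Ṙ-lhs-reducible : ∀ {ℓ r} → Ṙ ℓ r → Reducible R̈ ℓ
  Ṙ-lhs-reducible = go (≺-wellFounded _)
    where
    go : ∀ {ℓ r} → Acc _≺_ ℓ → Ṙ ℓ r → Reducible R̈ ℓ
    go {ℓ} {r} (acc rs) Ṙℓr with em {Reducible (Ṙ ∖⟨ ℓ , r ⟩) ℓ}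
    ... | no normal       = r , step (Ṙℓr , normal)
    ... | yes (_ , ℓ→u) with redex ℓ→u
    ... | ℓ′ , r′ , (Ṙℓ′r′ , _) , inj₂ ℓ′≺ℓ , lift = lift (go (rs ℓ′≺ℓ) Ṙℓ′r′)
    ... | ℓ′ , r′ , (Ṙℓ′r′ , differs) , inj₁ (σ , refl) , lift with variant-or-≺ ℓ′ σ
    ...   | inj₂ ℓ′≺ℓ       = lift (go (rs ℓ′≺ℓ) Ṙℓ′r′)
    ...   | inj₁ (π , ℓ′π≡) = contradiction (Ṙ-unique Ṙℓ′r′ Ṙℓr π ℓ′π≡) differs

  -- The representative of the rule has a renaming of `ℓ` as left-hand side; the inverse renaming
  -- brings its reduction back to `ℓ`.
  R-lhs-reducible : ∀ {ℓ r} → R ℓ r → Reducible R̈ ℓ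
  R-lhs-reducible {ℓ} {r} Rℓr with exists (r , Rℓr , refl)
  ... | _ , _ , Ṙℓ′r′ , π , refl , _ =
    subst (Reducible R̈) (rename-renameBack ℓ π) (Reducible-⟨⟩ (renameBack π) (Ṙ-lhs-reducible Ṙℓ′r′))

  R̈-normal⇒R-normal : ∀ {t} → IsNormalForm (Step R̈) t → IsNormalForm (Step R) t
  R̈-normal⇒R-normal nf red = nf (Reducible-lhs R-lhs-reducible red)

  -- Termination, joinability and the equivalences

  StepModulo-R̈⇒⁺ : StepModulo B R̈ ⇒ TransClosure (StepModulo B R)
  StepModulo-R̈⇒⁺ = StepModulo-least (Ṙ⇒⁺ ∘ proj₁)

  R/B-wellFounded : WellFounded (flip (StepModulo B R))
  R/B-wellFounded = terminating⇒wellFounded em (proj₁ complete)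

  R̈/B-wellFounded : WellFounded (flip (StepModulo B R̈))
  R̈/B-wellFounded = Subrelation.wellFounded (flip-TransClosure ∘ StepModulo-R̈⇒⁺)
                      (wellFounded _ R/B-wellFounded)

  -- A plain step is a step modulo B with empty conversions, so termination modulo B suffices.
  normalize : ∀ {S : ES 𝓕} → WellFounded (flip (StepModulo B S)) → ∀ t → ∃[ u ] Normalizes (Step S) t u
  normalize wf = normalizing em (Subrelation.wellFounded (λ x → _ , ε , _ , x , ε) wf)

  Conversion-R̈⇒R : Conversion (R̈ ∪ B) ⇒ Conversion (R ∪ B)
  Conversion-R̈⇒R = Conversion-least [ Ṙ⇒Conversion ∘ proj₁ , EqC.return ∘ step ∘ inj₂ ]′

  R̈-reduction⇒Conversion : Star (Step R̈) ⇒ Conversion (R ∪ B)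
  R̈-reduction⇒Conversion = Conversion-R̈⇒R ∘ Star⇒Conversion

  -- Normalizing both sides with `R̈` gives R-normal forms. Starting from conversions of `R ∪ B`
  -- serves both the Church-Rosser property of `R̈` and conversion equivalence.
  R̈-joins : Conversion (R ∪ B) ⇒ Star (Step R̈) ⨾ Conversion B ⨾ flip (Star (Step R̈))
  R̈-joins {s} {t} s↔t =
    let s′ , s→* , s′-nf = normalize R̈/B-wellFounded s
        t′ , t→* , t′-nf = normalize R̈/B-wellFounded t
    in s′ , s→* , t′ ,
       normalForms-convertible cr (R̈-normal⇒R-normal s′-nf) (R̈-normal⇒R-normal t′-nf)
         (EqC.symmetric _ (R̈-reduction⇒Conversion s→*) ◅◅ s↔t ◅◅ R̈-reduction⇒Conversion t→*) ,
       t→*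

  R̈-normalizationEquivalent : NormalizationEquivalentModulo B R̈ R
  R̈-normalizationEquivalent = R̈⇒R , R⇒R̈
    where
    -- Both normal forms are R-normal and convertible through `s`.
    same : ∀ {s u v} → Normalizes (Step R̈) s u → Normalizes (Step R) s v → Conversion B u v
    same (s→*u , u-nf) (s→*v , v-nf) = normalForms-convertible cr (R̈-normal⇒R-normal u-nf) v-nf
      (EqC.symmetric _ (R̈-reduction⇒Conversion s→*u) ◅◅ Star⇒Conversion s→*v)

    R̈⇒R : Normalizes (Step R̈) ⨾ Conversion B ⇒ Normalizes (Step R) ⨾ Conversion B
    R̈⇒R {s} (_ , s→!u , u~t) =
      let v , s→!v = normalize R/B-wellFounded s
      in v , s→!v , EqC.symmetric _ (same s→!u s→!v) ◅◅ u~t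

    R⇒R̈ : Normalizes (Step R) ⨾ Conversion B ⇒ Normalizes (Step R̈) ⨾ Conversion B
    R⇒R̈ {s} (_ , s→!v , v~t) =
      let u , s→!u = normalize R̈/B-wellFounded s
      in u , s→!u , same s→!u s→!v ◅◅ v~t

  R̈-conversionEquivalent : ConversionEquivalentModulo B R̈ R
  R̈-conversionEquivalent = Conversion-R̈⇒R , λ s↔t →
    let _ , s→* , _ , ~ , t→* = R̈-joins s↔t
    in Star⇒Conversion s→* ◅◅ EqC.map (Step-mono inj₂) ~ ◅◅ EqC.symmetric _ (Star⇒Conversion t→*)

  -- Removing the same rule from `R̈` and `Ṙ` preserves the inclusion, and `ℓ` is normal for the
  -- larger remainder.
  R̈-leftReduced : LeftReduced R̈
  R̈-leftReduced (_ , nf) (_ , x) = nf (_ , Step-mono (λ { ((Ṙℓr , _) , differs) → Ṙℓr , differs }) x)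

  -- A step from `r` would yield a nonempty R/B-sequence, whose first step contradicts normality of
  -- `r`.
  R̈-rightReduced : RightReducedModulo B R̈
  R̈-rightReduced (Ṙℓr , _) (_ , x) with StepModulo-R̈⇒⁺ x
  ... | [ y ]   = Ṙ-rhs-normal Ṙℓr (_ , y)
  ... | (y ∷ _) = Ṙ-rhs-normal Ṙℓr (_ , y)

  R̈-canonical : CanonicalModulo B R̈
  R̈-canonical = (wellFounded⇒terminating R̈/B-wellFounded , R̈-joins ∘ Conversion-R̈⇒R) ,
                (λ {ℓ} {r} → R̈-leftReduced {ℓ} {r}) , R̈-rightReduced

theorem6p12 : ExcludedMiddle 0ℓ →
    (𝓕 : Signature) (B : ES 𝓕) → VariablePreserving B →
    (R : ES 𝓕) → IsTRS R → CompleteModulo B R →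
    (Ṙ : ES 𝓕) → IsDot B R Ṙ →
    let R̈ = LeftReduce Ṙ in
    IsTRS R̈ ×
    NormalizationEquivalentModulo B R̈ R ×
    ConversionEquivalentModulo B R̈ R ×
    CanonicalModulo B R̈
theorem6p12 em 𝓕 B vp R trs complete Ṙ dot =
    (λ (Ṙℓr , _) → Ṙ-isTRS em B vp R trs complete Ṙ dot Ṙℓr)
  , R̈-normalizationEquivalent em B vp R trs complete Ṙ dot
  , R̈-conversionEquivalent em B vp R trs complete Ṙ dot
  , R̈-canonical em B vp R trs complete Ṙ dot
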